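{- Let $\Delta$ be a proper geometric simplicial complex in $\mathbb{R}^d$, let $\omega$ be a linear differential, and let $k\ge 0$ be an integer. Assume that $(\Delta,\omega)$ is toric $k$-chordal and that $\Delta$ has no missing faces of dimension $k+1$. Then $(\Delta,\omega)$ is toric $(k+1)$-chordal.
   Context: A geometric simplicial complex in $\mathbb{R}^d$ is a finite abstract simplicial complex $\Delta$ with vertex set $\Delta^{(0)}$ together with a map $v\mapsto p_v\in\mathbb{R}^d$ on vertices (not necessarily inducing an embedding of the complex). It is proper if for every $j<d$ the image of the vertex set of every $j$-dimensional face linearly spans a subspace of dimension $j+1$. Let $\widetilde S(\Delta)\subset\mathbb{R}[x_v: v\in\Delta^{(0)}]$ be the linear span of all monomials whose support is a face of $\Delta$. The stress space is $S(\Delta)=\{q\in\widetilde S(\Delta):\sum_{v}\frac{\partial q}{\partial x_v}\,p_v=0\}$, and $S_k(\Delta)$ is its homogeneous part of degree $k$ (zero if $k<0$). A linear differential is an operator $\omega=\sum_v a_v\frac{\partial}{\partial x_v}$ with $a_v\in\mathbb{R}$. $(\Delta,\omega)$ is toric $k$-chordal if $\omega:S_{k+1}(\Delta)\to S_k(\Delta)$ is surjective and $\omega:S_k(\Delta)\to S_{k-1}(\Delta)$ is injective. A missing face of $\Delta$ is an inclusion-minimal subset $\sigma\subset\Delta^{(0)}$ that is not a face of $\Delta$; its dimension is $\#\sigma-1$. -}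

module Defs where

open import Algebra.Bundles using (CommutativeRing)
import Algebra.Properties.Monoid.Mult as Mult
import Algebra.Properties.Monoid.Sum as Sum
open import Data.Bool.Base using (if_then_else_)
open import Data.Fin.Base using (Fin)
open import Data.Fin.Subset using (Subset; Side; inside; outside; _∈_; _∉_; _⊆_; ⁅_⁆; ∣_∣)
open import Data.Integer.Base as ℤ using (ℤ; +_)
open import Data.List.Base as List using (List; []; _∷_)
open import Data.List.Relation.Unary.All using (All)
open import Data.Nat.Base as ℕ using (ℕ; zero; suc)
import Data.Nat.Properties as ℕₚ
open import Data.Product.Base using (∃; ∃-syntax; _×_; _,_; proj₁; proj₂)
open import Data.Rational.Base as ℚ using (ℚ; 0ℚ; 1ℚ; ½)
import Data.Rational.Properties as ℚₚ
open import Data.Rational.Solver using (module +-*-Solver)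
open import Data.Vec.Base as Vec using (Vec)
import Data.Vec.Functional as Functional
open import Data.Vec.Properties using (≡-dec)
open import Function.Base using (_∘_)
open import Function.Bundles using (_⇔_)
open import Level using (0ℓ)
open import Relation.Binary.PropositionalEquality
  using (_≡_; refl; sym; trans; cong; cong₂; subst; subst₂)
open import Relation.Nullary using (¬_; does)
open import Relation.Unary using (Pred; Decidable)

------------------------------------------------------------------------
-- The real numbers: Cauchy sequences of rationals modulo null sequences

-- x and y have the same limit.  The two indices are independent, so that
-- x ~ x says exactly that x is a Cauchy sequence.
infix 4 _~_

record _~_ (x y : ℕ → ℚ) : Set where
  field
    close : ∀ ε → 0ℚ ℚ.< ε →
      ∃[ N ] (∀ m n → N ℕ.≤ m → N ℕ.≤ n → ℚ.∣ x m ℚ.- y n ∣ ℚ.< ε)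

open _~_ public

record ℝ : Set where
  constructor mkℝ
  field
    seq    : ℕ → ℚ
    cauchy : seq ~ seq

open ℝ public

infix 4 _≈ℝ_

record _≈ℝ_ (x y : ℝ) : Set where
  constructor mk≈
  field
    same-limit : seq x ~ seq y

open _≈ℝ_ public

private
  ½-pos : ∀ {ε} → 0ℚ ℚ.< ε → 0ℚ ℚ.< ½ ℚ.* ε
  ½-pos {ε} 0<ε = subst (ℚ._< ½ ℚ.* ε) (ℚₚ.*-zeroʳ ½) (ℚₚ.*-monoʳ-<-pos ½ 0<ε)

  ½+½ : ∀ ε → ½ ℚ.* ε ℚ.+ ½ ℚ.* ε ≡ ε
  ½+½ ε = trans (sym (ℚₚ.*-distribʳ-+ ε ½ ½)) (ℚₚ.*-identityˡ ε)

  triangle : ∀ {a b c ε} → a ≡ b ℚ.+ c →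
             ℚ.∣ b ∣ ℚ.< ½ ℚ.* ε → ℚ.∣ c ∣ ℚ.< ½ ℚ.* ε → ℚ.∣ a ∣ ℚ.< ε
  triangle {b = b} {c} {ε} refl b< c< =
    ℚₚ.≤-<-trans (ℚₚ.∣p+q∣≤∣p∣+∣q∣ b c)
      (subst (ℚ.∣ b ∣ ℚ.+ ℚ.∣ c ∣ ℚ.<_) (½+½ ε) (ℚₚ.+-mono-< b< c<))

  ~-sym : ∀ {x y} → x ~ y → y ~ x
  ~-sym {x} {y} x~y .close ε 0<ε with close x~y ε 0<ε
  ... | N , h = N , λ m n N≤m N≤n →
    subst (ℚ._< ε)
      (trans (sym (ℚₚ.∣-p∣≡∣p∣ (x n ℚ.- y m)))
             (cong ℚ.∣_∣ (solve 2 (λ a b → :- (a :- b) := b :- a) refl (x n) (y m))))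
      (h n m N≤n N≤m)
    where open +-*-Solver

  ~-trans : ∀ {x y z} → x ~ y → y ~ z → x ~ z
  ~-trans {x} {y} {z} x~y y~z .close ε 0<ε
    with close x~y (½ ℚ.* ε) (½-pos 0<ε) | close y~z (½ ℚ.* ε) (½-pos 0<ε)
  ... | N , h | M , k = N ℕ.⊔ M , λ m n p q →
    triangle
      (solve 3 (λ a b c → a :- c := (a :- b) :+ (b :- c)) refl (x m) (y (N ℕ.⊔ M)) (z n))
      (h m (N ℕ.⊔ M) (ℕₚ.≤-trans (ℕₚ.m≤m⊔n N M) p) (ℕₚ.m≤m⊔n N M))
      (k (N ℕ.⊔ M) n (ℕₚ.m≤n⊔m N M) (ℕₚ.≤-trans (ℕₚ.m≤n⊔m N M) q))
    where open +-*-Solver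

  ~-pointwise : ∀ {x y} → x ~ x → (∀ n → x n ≡ y n) → x ~ y
  ~-pointwise {x} c x≡y .close ε 0<ε with close c ε 0<ε
  ... | N , h = N , λ m n p q →
    subst (λ t → ℚ.∣ x m ℚ.- t ∣ ℚ.< ε) (x≡y n) (h m n p q)

  ~-const : ∀ c → (λ _ → c) ~ (λ _ → c)
  ~-const c .close ε 0<ε = 0 , λ _ _ _ _ →
    subst (λ t → ℚ.∣ t ∣ ℚ.< ε) (sym (ℚₚ.+-inverseʳ c)) 0<ε

  ~-+ : ∀ {x x′ y y′} → x ~ x′ → y ~ y′ →
        (λ n → x n ℚ.+ y n) ~ (λ n → x′ n ℚ.+ y′ n)
  ~-+ {x} {x′} {y} {y′} x~x′ y~y′ .close ε 0<ε
    with close x~x′ (½ ℚ.* ε) (½-pos 0<ε) | close y~y′ (½ ℚ.* ε) (½-pos 0<ε)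
  ... | N , h | M , k = N ℕ.⊔ M , λ m n p q →
    triangle
      (solve 4 (λ a b a′ b′ → (a :+ b) :- (a′ :+ b′) := (a :- a′) :+ (b :- b′)) refl
         (x m) (y m) (x′ n) (y′ n))
      (h m n (ℕₚ.≤-trans (ℕₚ.m≤m⊔n N M) p) (ℕₚ.≤-trans (ℕₚ.m≤m⊔n N M) q))
      (k m n (ℕₚ.≤-trans (ℕₚ.m≤n⊔m N M) p) (ℕₚ.≤-trans (ℕₚ.m≤n⊔m N M) q))
    where open +-*-Solver

  ~-neg : ∀ {x y} → x ~ y → (λ n → ℚ.- x n) ~ (λ n → ℚ.- y n)
  ~-neg {x} {y} x~y .close ε 0<ε with close x~y ε 0<ε
  ... | N , h = N , λ m n p q →
    subst (ℚ._< ε)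
      (trans (sym (ℚₚ.∣-p∣≡∣p∣ (x m ℚ.- y n)))
             (cong ℚ.∣_∣ (solve 2 (λ a b → :- (a :- b) := :- a :- (:- b)) refl (x m) (y n))))
      (h m n p q)
    where open +-*-Solver

  0<1 : 0ℚ ℚ.< 1ℚ
  0<1 = ℚₚ.positive⁻¹ 1ℚ

  bounded : ∀ {x y} → x ~ y →
            ∃[ B ] (0ℚ ℚ.< B × ∃[ N ] (∀ n → N ℕ.≤ n → ℚ.∣ x n ∣ ℚ.≤ B))
  bounded {x} {y} x~y with close x~y 1ℚ 0<1
  ... | N , h =
    1ℚ ℚ.+ ℚ.∣ y N ∣ ,
    ℚₚ.+-mono-<-≤ 0<1 (ℚₚ.0≤∣p∣ (y N)) ,
    N , λ n N≤n →
      ℚₚ.≤-trans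
        (subst (λ t → ℚ.∣ t ∣ ℚ.≤ ℚ.∣ x n ℚ.- y N ∣ ℚ.+ ℚ.∣ y N ∣)
          (solve 2 (λ a b → (a :- b) :+ b := a) refl (x n) (y N))
          (ℚₚ.∣p+q∣≤∣p∣+∣q∣ (x n ℚ.- y N) (y N)))
        (ℚₚ.+-mono-≤ (ℚₚ.<⇒≤ (h n N N≤n ℕₚ.≤-refl)) ℚₚ.≤-refl)
    where open +-*-Solver

  quotient : ∀ B ε → 0ℚ ℚ.< B → 0ℚ ℚ.< ε → ∃[ δ ] (0ℚ ℚ.< δ × B ℚ.* δ ≡ ε)
  quotient B ε 0<B 0<ε =
    (ℚ.1/ B) ℚ.* ε ,
    ℚₚ.positive⁻¹ _ {{ℚₚ.pos*pos⇒pos (ℚ.1/ B) {{ℚₚ.1/pos⇒pos B}} ε}} ,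
    trans (sym (ℚₚ.*-assoc B (ℚ.1/ B) ε))
      (trans (cong (ℚ._* ε) (ℚₚ.*-inverseʳ B)) (ℚₚ.*-identityˡ ε))
    where
    instance
      B-pos : ℚ.Positive B
      B-pos = ℚ.positive 0<B
      ε-pos : ℚ.Positive ε
      ε-pos = ℚ.positive 0<ε
      B-nonZero : ℚ.NonZero B
      B-nonZero = ℚₚ.pos⇒nonZero B

  ∣*∣-bound : ∀ {a b B δ ε} → 0ℚ ℚ.< B → B ℚ.* δ ≡ ε →
              ℚ.∣ a ∣ ℚ.≤ B → ℚ.∣ b ∣ ℚ.< δ → ℚ.∣ a ℚ.* b ∣ ℚ.< ε
  ∣*∣-bound {a} {b} {B} 0<B refl a≤B b<δ =
    subst (ℚ._< _) (sym (ℚₚ.∣p*q∣≡∣p∣*∣q∣ a b))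
      (ℚₚ.≤-<-trans
        (ℚₚ.*-monoʳ-≤-nonNeg ℚ.∣ b ∣ {{ℚ.nonNegative (ℚₚ.0≤∣p∣ b)}} a≤B)
        (ℚₚ.*-monoʳ-<-pos B {{ℚ.positive 0<B}} b<δ))

  product-difference : ∀ a b a′ b′ →
    a ℚ.* b ℚ.- a′ ℚ.* b′ ≡ a ℚ.* (b ℚ.- b′) ℚ.+ b′ ℚ.* (a ℚ.- a′)
  product-difference = solve 4
    (λ a b a′ b′ → (a :* b) :- (a′ :* b′) := (a :* (b :- b′)) :+ (b′ :* (a :- a′))) refl
    where open +-*-Solver

  ~-* : ∀ {x x′ y y′} → x ~ x′ → y ~ y′ →
        (λ n → x n ℚ.* y n) ~ (λ n → x′ n ℚ.* y′ n)
  ~-* {x} {x′} {y} {y′} x~x′ y~y′ .close ε 0<ε =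
    let A , 0<A , K , x≤A  = bounded x~x′
        B , 0<B , L , y′≤B = bounded (~-sym y~y′)
        γ , 0<γ , Aγ       = quotient A (½ ℚ.* ε) 0<A (½-pos 0<ε)
        δ , 0<δ , Bδ       = quotient B (½ ℚ.* ε) 0<B (½-pos 0<ε)
        M , k              = close y~y′ γ 0<γ
        N , h              = close x~x′ δ 0<δ
    in (K ℕ.⊔ L) ℕ.⊔ (M ℕ.⊔ N) , λ m n p q →
      let p₁ = ℕₚ.m⊔n≤o⇒m≤o (K ℕ.⊔ L) (M ℕ.⊔ N) p
          p₂ = ℕₚ.m⊔n≤o⇒n≤o (K ℕ.⊔ L) (M ℕ.⊔ N) p
          q₁ = ℕₚ.m⊔n≤o⇒m≤o (K ℕ.⊔ L) (M ℕ.⊔ N) q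
          q₂ = ℕₚ.m⊔n≤o⇒n≤o (K ℕ.⊔ L) (M ℕ.⊔ N) q
      in triangle {b = x m ℚ.* (y m ℚ.- y′ n)} {c = y′ n ℚ.* (x m ℚ.- x′ n)}
           (product-difference (x m) (y m) (x′ n) (y′ n))
           (∣*∣-bound {a = x m} {b = y m ℚ.- y′ n} 0<A Aγ
             (x≤A m (ℕₚ.m⊔n≤o⇒m≤o K L p₁))
             (k m n (ℕₚ.m⊔n≤o⇒m≤o M N p₂) (ℕₚ.m⊔n≤o⇒m≤o M N q₂)))
           (∣*∣-bound {a = y′ n} {b = x m ℚ.- x′ n} 0<B Bδ
             (y′≤B n (ℕₚ.m⊔n≤o⇒n≤o K L q₁))
             (h m n (ℕₚ.m⊔n≤o⇒n≤o M N p₂) (ℕₚ.m⊔n≤o⇒n≤o M N q₂)))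

  pointwise : ∀ {x y} → (∀ n → seq x n ≡ seq y n) → x ≈ℝ y
  pointwise {x} x≡y = mk≈ (~-pointwise (cauchy x) x≡y)

fromℚ : ℚ → ℝ
fromℚ c = mkℝ (λ _ → c) (~-const c)

ℝ-ring : CommutativeRing 0ℓ 0ℓ
ℝ-ring = record
  { Carrier = ℝ
  ; _≈_ = _≈ℝ_
  ; _+_ = λ x y → mkℝ (λ n → seq x n ℚ.+ seq y n) (~-+ (cauchy x) (cauchy y))
  ; _*_ = λ x y → mkℝ (λ n → seq x n ℚ.* seq y n) (~-* (cauchy x) (cauchy y))
  ; -_ = λ x → mkℝ (λ n → ℚ.- seq x n) (~-neg (cauchy x))
  ; 0# = fromℚ 0ℚ
  ; 1# = fromℚ 1ℚ
  ; isCommutativeRing = record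
    { isRing = record
      { +-isAbelianGroup = record
        { isGroup = record
          { isMonoid = record
            { isSemigroup = record
              { isMagma = record
                { isEquivalence = record
                  { refl = λ {x} → mk≈ (cauchy x)
                  ; sym = λ p → mk≈ (~-sym (same-limit p))
                  ; trans = λ p q → mk≈ (~-trans (same-limit p) (same-limit q))
                  }
                ; ∙-cong = λ p q → mk≈ (~-+ (same-limit p) (same-limit q))
                }
              ; assoc = λ x y z → pointwise λ n → ℚₚ.+-assoc (seq x n) (seq y n) (seq z n)
              }
            ; identity = (λ x → pointwise λ n → ℚₚ.+-identityˡ (seq x n))
                       , (λ x → pointwise λ n → ℚₚ.+-identityʳ (seq x n))
            }
          ; inverse = (λ x → pointwise λ n → ℚₚ.+-inverseˡ (seq x n))
                    , (λ x → pointwise λ n → ℚₚ.+-inverseʳ (seq x n))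
          ; ⁻¹-cong = λ p → mk≈ (~-neg (same-limit p))
          }
        ; comm = λ x y → pointwise λ n → ℚₚ.+-comm (seq x n) (seq y n)
        }
      ; *-cong = λ p q → mk≈ (~-* (same-limit p) (same-limit q))
      ; *-assoc = λ x y z → pointwise λ n → ℚₚ.*-assoc (seq x n) (seq y n) (seq z n)
      ; *-identity = (λ x → pointwise λ n → ℚₚ.*-identityˡ (seq x n))
                   , (λ x → pointwise λ n → ℚₚ.*-identityʳ (seq x n))
      ; distrib = (λ x y z → pointwise λ n → ℚₚ.*-distribˡ-+ (seq x n) (seq y n) (seq z n))
                , (λ x y z → pointwise λ n → ℚₚ.*-distribʳ-+ (seq x n) (seq y n) (seq z n))
      }
    ; *-comm = λ x y → pointwise λ n → ℚₚ.*-comm (seq x n) (seq y n)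
    }
  }

open CommutativeRing ℝ-ring using (_≈_; _+_; _*_; 0#; +-monoid)
open Sum +-monoid using (sum)
open Mult +-monoid using () renaming (_×_ to _·_)

------------------------------------------------------------------------
-- Linear algebra in ℝᵈ

Vector : ℕ → Set
Vector d = Functional.Vector ℝ d

infix 4 _≋_

_≋_ : ∀ {d} → Vector d → Vector d → Set
x ≋ y = ∀ i → x i ≈ y i

combination : ∀ {m d} → Vector m → (Fin m → Vector d) → Vector d
combination c b i = sum (λ j → c j * b j i)

LinearlyIndependent : ∀ {m d} → (Fin m → Vector d) → Set
LinearlyIndependent b = ∀ c → combination c b ≋ (λ _ → 0#) → ∀ j → c j ≈ 0#

HasDimension : ∀ {d} → Pred (Vector d) 0ℓ → ℕ → Set
HasDimension {d} U m = ∃[ b ] (LinearlyIndependent {m} {d} b ×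
  (∀ x → U x ⇔ (∃[ c ] x ≋ combination c b)))

-- The linear span of the vectors p v with v ∈ σ.
SpanOf : ∀ {n d} → (Fin n → Vector d) → Subset n → Pred (Vector d) 0ℓ
SpanOf p σ x = ∃[ c ] ((∀ v → v ∉ σ → c v ≈ 0#) × x ≋ combination c p)

------------------------------------------------------------------------
-- Simplicial complexes on the vertex set Fin n

record SimplicialComplex (n : ℕ) : Set₁ where
  field
    Face        : Pred (Subset n) 0ℓ
    face?       : Decidable Face
    down-closed : ∀ {σ τ} → τ ⊆ σ → Face σ → Face τ
    vertex      : ∀ v → Face ⁅ v ⁆

-- Integer-valued, so that the empty set has dimension -1.
dim : ∀ {n} → Subset n → ℤ
dim σ = + ∣ σ ∣ ℤ.- + 1

record GeometricComplex (n d : ℕ) : Set₁ where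
  field
    complex  : SimplicialComplex n
    position : Fin n → Vector d

  open SimplicialComplex complex public

MissingFace : ∀ {n d} → GeometricComplex n d → Pred (Subset n) 0ℓ
MissingFace Δ σ = ¬ Face σ × (∀ τ → τ ⊆ σ → ¬ Face τ → τ ≡ σ)
  where open GeometricComplex Δ

Proper : ∀ {n d} → GeometricComplex n d → Set
Proper {d = d} Δ = ∀ j → j ℕ.< d → ∀ σ → Face σ → dim σ ≡ + j →
  HasDimension (SpanOf position σ) (suc j)
  where open GeometricComplex Δ

------------------------------------------------------------------------
-- Real polynomials in the variables x_v, v : Fin n

Monomial : ℕ → Set
Monomial n = Vec ℕ n

support : ∀ {n} → Monomial n → Subset n
support = Vec.map side
  where
  side : ℕ → Side
  side zero    = outside
  side (suc _) = inside

degree : ∀ {n} → Monomial n → ℕ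
degree = Vec.sum

-- A formal sum of terms c·xᵅ, in which monomials may repeat and
-- coefficients may vanish; two such sums denote the same polynomial
-- when _≈ᴾ_ holds.
Poly : ℕ → Set
Poly n = List (ℝ × Monomial n)

coeff : ∀ {n} → Poly n → Monomial n → ℝ
coeff []            α = 0#
coeff ((c , β) ∷ q) α = (if does (≡-dec ℕₚ._≟_ β α) then c else 0#) + coeff q α

infix 4 _≈ᴾ_

_≈ᴾ_ : ∀ {n} → Poly n → Poly n → Set
q ≈ᴾ r = ∀ α → coeff q α ≈ coeff r α

MonomialSpan : ∀ {n} → Pred (Monomial n) 0ℓ → Pred (Poly n) 0ℓ
MonomialSpan P q = ∃[ r ] (All (P ∘ proj₂) r × q ≈ᴾ r)

∂ : ∀ {n} → Fin n → Poly n → Poly n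
∂ v = List.concatMap λ (c , α) → term c α (Vec.lookup α v)
  where
  term : ℝ → Monomial _ → ℕ → Poly _
  term c α zero    = []
  term c α (suc m) = (suc m · c , α Vec.[ v ]≔ m) ∷ []

scale : ∀ {n} → ℝ → Poly n → Poly n
scale a = List.map λ (c , α) → (a * c , α)

-- The linear differential Σᵥ aᵥ ∂/∂xᵥ; addition of formal sums is
-- concatenation.
differential : ∀ {n} → Vector n → Poly n → Poly n
differential {n} a q = List.concatMap (λ v → scale (a v) (∂ v q)) (List.allFin n)

------------------------------------------------------------------------
-- Stress spaces and toric chordality

module _ {n d} (Δ : GeometricComplex n d) where
  open GeometricComplex Δ

  FacePolynomial : Pred (Poly n) 0ℓ
  FacePolynomial = MonomialSpan (Face ∘ support)

  -- The equation Σᵥ (∂q/∂xᵥ) pᵥ = 0 lives in ℝ[x]ᵈ and is stated one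
  -- coordinate of ℝᵈ at a time.
  Stress : Pred (Poly n) 0ℓ
  Stress q = FacePolynomial q × (∀ i → differential (λ v → position v i) q ≈ᴾ [])

  -- For k < 0 no monomial has degree k, so only the zero polynomial remains.
  StressOfDegree : ℤ → Pred (Poly n) 0ℓ
  StressOfDegree k q = Stress q × MonomialSpan (λ α → + degree α ≡ k) q

  ToricChordal : Vector n → ℤ → Set
  ToricChordal a k =
    (∀ q → StressOfDegree k q →
       ∃[ r ] (StressOfDegree (ℤ.suc k) r × differential a r ≈ᴾ q))
    × (∀ q r → StressOfDegree k q → StressOfDegree k r →
       differential a q ≈ᴾ differential a r → q ≈ᴾ r)

{-# OPTIONS --safe #-}

-- Partial derivatives map stresses to stresses, lower the degree by one and
-- commute with ω, and a homogeneous polynomial of positive degree is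
-- determined by its partial derivatives.  Injectivity of ω therefore passes
-- from degree k to degree k + 1.  For surjectivity, let q be a stress of
-- degree k + 1 and choose stresses g_v of degree k + 1 with ω g_v = ∂_v q.
-- Injectivity in degree k forces ∂_u g_v = ∂_v g_u, so by Euler's identity
-- r = (k + 2)⁻¹ Σ_v x_v g_v satisfies ∂_v r = g_v, and hence ω r = q.  If a
-- monomial α of degree k + 2 is not supported on a face although every
-- α / x_v (v ∈ supp α) is, then α is squarefree and its support is a missing
-- face of dimension k + 1; without such faces r is a face polynomial.
module Submission where

open import Algebra.Bundles using (CommutativeRing; Semiring)
open import Algebra.Morphism.Structures using (module SemiringMorphisms)
import Algebra.Properties.CommutativeMonoid.Mult as CommutativeMult
import Algebra.Properties.Monoid.Mult as Mult
import Algebra.Properties.Semiring.Mult as SemiringMult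
import Algebra.Properties.Semiring.Sum as SemiringSum
open import Data.Bool.Base using (true; false; if_then_else_)
open import Data.Fin.Base using (Fin; zero; suc)
import Data.Fin.Properties as Fin
open import Data.Fin.Subset using (_∈_; _⊆_; ∣_∣)
open import Data.Fin.Subset.Properties using (_∈?_; ⊆-antisym)
open import Data.Integer.Base as ℤ using (+_)
import Data.Integer.Properties as ℤₚ
open import Data.List.Base as List using (List; []; _∷_; _++_)
open import Data.List.Relation.Binary.Pointwise as Pointwise using (Pointwise; []; _∷_)
open import Data.List.Relation.Unary.All using (All; []; _∷_)
open import Data.List.Relation.Unary.All.Properties using (all-filter)
open import Data.Nat.Base as ℕ using (ℕ; zero; suc; z≤n; s≤s)
import Data.Nat.Properties as ℕₚ
open import Data.Product.Base using (∃-syntax; _×_; _,_; proj₁; proj₂)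
open import Data.Rational.Base as ℚ using (ℚ; 0ℚ; 1ℚ)
import Data.Rational.Properties as ℚₚ
open import Data.Sum.Base using (_⊎_; inj₁; inj₂)
open import Data.Vec.Base as Vec using (Vec; []; _∷_; lookup; _[_]≔_; here; there)
open import Data.Vec.Properties
  using (≡-dec; updateAt-updateAt; updateAt-id-local; updateAt-commutes;
         lookup∘updateAt; lookup∘updateAt′)
open import Function.Base using (_∘_; id)
open import Function.Bundles using (mk⇔)
open import Level using (0ℓ)
open import Relation.Binary.PropositionalEquality as ≡ using (_≡_; _≢_)
open import Relation.Nullary using (¬_; does; yes; no; contradiction)
open import Relation.Nullary.Decidable using (dec-true; dec-false; does-⇔)
open import Relation.Unary using (Pred; Decidable)

open import Defs using (Monomial; degree; support)

open Mult ℚₚ.+-0-monoid using () renaming (_×_ to _·ℚ_)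

private
  variable
    n d : ℕ

-- Natural multiples of 1 in ℚ.

·ℚ-nonNegative : ∀ m → 0ℚ ℚ.≤ m ·ℚ 1ℚ
·ℚ-nonNegative zero    = ℚₚ.≤-refl
·ℚ-nonNegative (suc m) = ℚₚ.+-mono-≤ (ℚₚ.nonNegative⁻¹ 1ℚ) (·ℚ-nonNegative m)

·ℚ-nonZero : ∀ m → ℚ.NonZero (suc m ·ℚ 1ℚ)
·ℚ-nonZero m = ℚ.>-nonZero (ℚₚ.+-mono-<-≤ (ℚₚ.positive⁻¹ 1ℚ) (·ℚ-nonNegative m))

-- Exponent vectors

-- Multiplication by x_v. The quotient α / x_v appears as `α [ v ]≔ m`, where `lookup α v ≡ suc m`.
raise : Fin n → Monomial n → Monomial n
raise v α = Vec.updateAt α v suc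

raise-lower : ∀ v (α : Monomial n) {m} → lookup α v ≡ suc m → raise v (α [ v ]≔ m) ≡ α
raise-lower v α e = ≡.trans (updateAt-updateAt v α) (updateAt-id-local v α (≡.sym e))

lower-raise : ∀ v (α : Monomial n) → raise v α [ v ]≔ lookup α v ≡ α
lower-raise v α = ≡.trans (updateAt-updateAt v α) (updateAt-id-local v α ≡.refl)

lookup-raise : ∀ v (α : Monomial n) → lookup (raise v α) v ≡ suc (lookup α v)
lookup-raise v α = lookup∘updateAt v α

lower-unique : ∀ v {β α : Monomial n} {m} → lookup β v ≡ suc m → β ≡ raise v α → β [ v ]≔ m ≡ α
lower-unique v {α = α} e ≡.refl =
  ≡.trans (≡.cong (raise v α [ v ]≔_) (ℕₚ.suc-injective (≡.trans (≡.sym e) (lookup-raise v α))))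
    (lower-raise v α)

raise-injective : ∀ v {β α : Monomial n} → raise v β ≡ raise v α → β ≡ α
raise-injective v {β} e = ≡.trans (≡.sym (lower-raise v β)) (lower-unique v (lookup-raise v β) e)

degree-raise : ∀ v (α : Monomial n) → degree (raise v α) ≡ suc (degree α)
degree-raise zero    (x ∷ α) = ≡.refl
degree-raise (suc v) (x ∷ α) = ≡.trans (≡.cong (x ℕ.+_) (degree-raise v α)) (ℕₚ.+-suc x _)

degree-lower : ∀ v (α : Monomial n) {m} → lookup α v ≡ suc m →
               degree α ≡ suc (degree (α [ v ]≔ m))
degree-lower v α e =
  ≡.trans (≡.cong degree (≡.sym (raise-lower v α e))) (degree-raise v (α [ v ]≔ _))

degree≡0⊎positive-exponent : (α : Monomial n) →
  degree α ≡ 0 ⊎ ∃[ v ] ∃[ m ] lookup α v ≡ suc m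
degree≡0⊎positive-exponent []          = inj₁ ≡.refl
degree≡0⊎positive-exponent (suc x ∷ α) = inj₂ (zero , x , ≡.refl)
degree≡0⊎positive-exponent (zero ∷ α) with degree≡0⊎positive-exponent α
... | inj₁ e           = inj₁ e
... | inj₂ (v , m , e) = inj₂ (suc v , m , e)

degree≡0⇒lookup≡0 : (α : Monomial n) → degree α ≡ 0 → ∀ v → lookup α v ≡ 0
degree≡0⇒lookup≡0 (zero ∷ α) e zero    = ≡.refl
degree≡0⇒lookup≡0 (zero ∷ α) e (suc v) = degree≡0⇒lookup≡0 α e v

∈-support⁺ : ∀ (α : Monomial n) v {m} → lookup α v ≡ suc m → v ∈ support α
∈-support⁺ (suc x ∷ α) zero    e = here
∈-support⁺ (x ∷ α)     (suc v) e = there (∈-support⁺ α v e)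

∈-support⁻ : ∀ (α : Monomial n) v → v ∈ support α → ∃[ m ] lookup α v ≡ suc m
∈-support⁻ (suc x ∷ α) zero    here      = x , ≡.refl
∈-support⁻ (x ∷ α)     (suc v) (there p) = ∈-support⁻ α v p

∈-support-lower : ∀ (α : Monomial n) {v w m} → w ≢ v → w ∈ support α →
                  w ∈ support (α [ v ]≔ m)
∈-support-lower α {v} {w} w≢v w∈ with ∈-support⁻ α w w∈
... | l , e = ∈-support⁺ (α [ v ]≔ _) w (≡.trans (lookup∘updateAt′ w v w≢v α) e)

-- Turns the degree of a nonface monomial into the dimension of its support.
∣support∣≡degree : (α : Monomial n) → (∀ v → lookup α v ℕ.≤ 1) → ∣ support α ∣ ≡ degree α
∣support∣≡degree []                _    = ≡.refl
∣support∣≡degree (zero ∷ α)        sqf  = ∣support∣≡degree α (sqf ∘ suc)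
∣support∣≡degree (suc zero ∷ α)    sqf  = ≡.cong suc (∣support∣≡degree α (sqf ∘ suc))
∣support∣≡degree (suc (suc _) ∷ α) sqf with sqf zero
... | s≤s ()

-- Polynomials over a commutative ℚ-algebra

-- The definitions of Defs with an abstract ring in place of ℝ: over the concrete
-- ring, comparing two real numbers makes Agda unfold their proofs of being Cauchy.
module Polynomials (R : CommutativeRing 0ℓ 0ℓ) {ι : ℚ → CommutativeRing.Carrier R}
  (ι-homomorphic : SemiringMorphisms.IsSemiringHomomorphism ℚ.+-*-rawSemiring
    (Semiring.rawSemiring (CommutativeRing.semiring R)) ι) where

  open CommutativeRing R hiding (zero)
  open SemiringMorphisms.IsSemiringHomomorphism ι-homomorphic
  open SemiringSum semiring using (sum; sum-cong-≋; sum-replicate-zero)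
  open SemiringMult semiring using (×-comm-*; ×-assoc-*)
  open CommutativeMult +-commutativeMonoid using (×-distrib-+)
  open Mult +-monoid using (×-congʳ; ×-congˡ; ×-assocˡ; ×-homo-+) renaming (_×_ to _·_)
  open import Relation.Binary.Reasoning.Setoid setoid

  -- Natural multiples, finite sums and reciprocals.

  ·-zeroʳ : ∀ m → m · 0# ≈ 0#
  ·-zeroʳ zero    = refl
  ·-zeroʳ (suc m) = trans (+-identityˡ _) (·-zeroʳ m)

  ·-comm : ∀ l m x → l · (m · x) ≈ m · (l · x)
  ·-comm l m x = begin
    l · (m · x)   ≈⟨ ×-assocˡ x l m ⟩
    (l ℕ.* m) · x ≈⟨ ×-congˡ {x} (ℕₚ.*-comm l m) ⟩
    (m ℕ.* l) · x ≈⟨ ×-assocˡ x m l ⟨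
    m · (l · x)   ∎

  ·-distrib-sum : ∀ m (f : Fin n → Carrier) → m · sum f ≈ sum (λ i → m · f i)
  ·-distrib-sum {n = zero}  m f = ·-zeroʳ m
  ·-distrib-sum {n = suc _} m f =
    trans (×-distrib-+ (f zero) _ m) (+-congˡ (·-distrib-sum m (f ∘ suc)))

  sum-0 : {f : Fin n → Carrier} → (∀ i → f i ≈ 0#) → sum f ≈ 0#
  sum-0 {n} f≈0 = trans (sum-cong-≋ f≈0) (sum-replicate-zero n)

  -- This is how the degree enters Euler's identity: for a monomial, `Vec.sum α` is `degree α`.
  sum-lookup-· : ∀ (α : Vec ℕ n) x → sum (λ v → lookup α v · x) ≈ Vec.sum α · x
  sum-lookup-· []      x = refl
  sum-lookup-· (y ∷ α) x =
    trans (+-congˡ (sum-lookup-· α x)) (sym (×-homo-+ x y (Vec.sum α)))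

  1/suc : ℕ → ℚ
  1/suc m = ℚ.1/_ (suc m ·ℚ 1ℚ) {{·ℚ-nonZero m}}

  -- The reciprocal of suc m, not of m.
  reciprocal : ℕ → Carrier
  reciprocal m = ι (1/suc m)

  -- Carries the inverses of positive integers from ℚ over to the ring.
  ·1≈ι : ∀ m → m · 1# ≈ ι (m ·ℚ 1ℚ)
  ·1≈ι zero    = sym 0#-homo
  ·1≈ι (suc m) = trans (+-cong (sym 1#-homo) (·1≈ι m)) (sym (+-homo 1ℚ (m ·ℚ 1ℚ)))

  reciprocal-inverse : ∀ m → reciprocal m * (suc m · 1#) ≈ 1#
  reciprocal-inverse m = begin
    reciprocal m * (suc m · 1#)       ≈⟨ *-congˡ (·1≈ι (suc m)) ⟩
    reciprocal m * ι (suc m ·ℚ 1ℚ)    ≈⟨ *-homo (1/suc m) (suc m ·ℚ 1ℚ) ⟨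
    ι (1/suc m ℚ.* (suc m ·ℚ 1ℚ))     ≡⟨ ≡.cong ι (ℚₚ.*-inverseˡ (suc m ·ℚ 1ℚ) {{·ℚ-nonZero m}}) ⟩
    ι 1ℚ                              ≈⟨ 1#-homo ⟩
    1#                                ∎

  reciprocal-· : ∀ m x → reciprocal m * (suc m · x) ≈ x
  reciprocal-· m x = begin
    reciprocal m * (suc m · x)        ≈⟨ *-congˡ (×-congʳ (suc m) (*-identityˡ x)) ⟨
    reciprocal m * (suc m · (1# * x)) ≈⟨ *-congˡ (×-assoc-* (suc m) 1# x) ⟨
    reciprocal m * (suc m · 1# * x)   ≈⟨ *-assoc _ _ x ⟨
    reciprocal m * (suc m · 1#) * x   ≈⟨ *-congʳ (reciprocal-inverse m) ⟩
    1# * x                            ≈⟨ *-identityˡ x ⟩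
    x                                 ∎

  -- Multiplying by `reciprocal m` undoes the factor. This recovers a coefficient of a polynomial
  -- from one of its derivative.
  ·-cancel : ∀ m {x y} → suc m · x ≈ suc m · y → x ≈ y
  ·-cancel m {x} {y} e =
    trans (sym (reciprocal-· m x)) (trans (*-congˡ e) (reciprocal-· m y))

  ·-cancel-0 : ∀ m {x} → suc m · x ≈ 0# → x ≈ 0#
  ·-cancel-0 m e = ·-cancel m (trans e (sym (·-zeroʳ (suc m))))

  -- Formal sums of terms and their derivatives.

  Poly : ℕ → Set
  Poly n = List (Carrier × Monomial n)

  coeff : Poly n → Monomial n → Carrier
  coeff []            α = 0#
  coeff ((c , β) ∷ q) α = (if does (≡-dec ℕₚ._≟_ β α) then c else 0#) + coeff q α

  infix 4 _≈ᴾ_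

  _≈ᴾ_ : Poly n → Poly n → Set
  q ≈ᴾ r = ∀ α → coeff q α ≈ coeff r α

  ∂-term : Fin n → Carrier → Monomial n → ℕ → Poly n
  ∂-term v c α zero    = []
  ∂-term v c α (suc m) = (suc m · c , α [ v ]≔ m) ∷ []

  ∂ : Fin n → Poly n → Poly n
  ∂ v = List.concatMap λ (c , α) → ∂-term v c α (lookup α v)

  scale : Carrier → Poly n → Poly n
  scale a = List.map λ (c , α) → (a * c , α)

  differential : (Fin n → Carrier) → Poly n → Poly n
  differential {n} a q = List.concatMap (λ v → scale (a v) (∂ v q)) (List.allFin n)

  coeff-++ : ∀ (q r : Poly n) α → coeff (q ++ r) α ≈ coeff q α + coeff r α
  coeff-++ []            r α = sym (+-identityˡ _)
  coeff-++ ((c , β) ∷ q) r α = trans (+-congˡ (coeff-++ q r α)) (sym (+-assoc _ _ _))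

  coeff-scale : ∀ a (q : Poly n) α → coeff (scale a q) α ≈ a * coeff q α
  coeff-scale a []            α = sym (zeroʳ a)
  coeff-scale a ((c , β) ∷ q) α with does (≡-dec ℕₚ._≟_ β α)
  ... | true  = trans (+-congˡ (coeff-scale a q α)) (sym (distribˡ a _ _))
  ... | false = begin
    0# + coeff (scale a q) α  ≈⟨ +-cong (sym (zeroʳ a)) (coeff-scale a q α) ⟩
    a * 0# + a * coeff q α    ≈⟨ distribˡ a _ _ ⟨
    a * (0# + coeff q α)      ∎

  -- The function `g` is arbitrary for the induction, whose tail tabulates `g ∘ suc`; the uses take
  -- `g = id`, since `allFin` is `tabulate id`.
  coeff-concatMap-tabulate : ∀ {m} {A : Set} (f : A → Poly n) (g : Fin m → A) α →
    coeff (List.concatMap f (List.tabulate g)) α ≈ sum (λ i → coeff (f (g i)) α)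
  coeff-concatMap-tabulate {m = zero}  f g α = refl
  coeff-concatMap-tabulate {m = suc _} f g α =
    trans (coeff-++ (f (g zero)) _ α) (+-congˡ (coeff-concatMap-tabulate f (g ∘ suc) α))

  -- Only terms with monomial x_v α contribute to α, each multiplied by the exponent of x_v. Later
  -- arguments about `∂` in this module work with this formula and not with the lists.
  coeff-∂ : ∀ v (q : Poly n) α → coeff (∂ v q) α ≈ suc (lookup α v) · coeff q (raise v α)
  coeff-∂ v []            α = sym (·-zeroʳ (suc (lookup α v)))
  coeff-∂ v ((c , β) ∷ q) α with lookup β v in eq
  -- The derivative drops this term, and β, not divisible by x_v, differs from x_v α.
  ... | zero
    rewrite dec-false (≡-dec ℕₚ._≟_ β (raise v α))
      (λ e → ℕₚ.0≢1+n (≡.trans (≡.sym eq) (≡.trans (≡.cong (λ γ → lookup γ v) e) (lookup-raise v α))))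
    = trans (coeff-∂ v q α) (×-congʳ (suc (lookup α v)) (sym (+-identityˡ _)))
  ... | suc m with ≡-dec ℕₚ._≟_ (β [ v ]≔ m) α
  ...   | yes ≡.refl
    rewrite dec-true (≡-dec ℕₚ._≟_ β (raise v (β [ v ]≔ m))) (≡.sym (raise-lower v β eq))
          | lookup∘updateAt v {λ _ → m} β
    = trans (+-congˡ (trans (coeff-∂ v q _) (×-congˡ (≡.cong suc (lookup∘updateAt v β)))))
        (sym (×-distrib-+ c _ (suc m)))
  -- Since β / x_v differs from α, β differs from x_v α, so the term contributes to neither side.
  ...   | no β≢
    rewrite dec-false (≡-dec ℕₚ._≟_ β (raise v α)) (β≢ ∘ lower-unique v eq)
    = trans (+-identityˡ _)
        (trans (coeff-∂ v q α) (×-congʳ (suc (lookup α v)) (sym (+-identityˡ _))))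

  coeff-∂-lower : ∀ v (q : Poly n) α {m} → lookup α v ≡ suc m →
                  coeff (∂ v q) (α [ v ]≔ m) ≈ suc m · coeff q α
  coeff-∂-lower v q α {m} e = begin
    coeff (∂ v q) (α [ v ]≔ m)                                   ≈⟨ coeff-∂ v q _ ⟩
    suc (lookup (α [ v ]≔ m) v) · coeff q (raise v (α [ v ]≔ m)) ≡⟨ ≡.cong₂ (λ l γ → suc l · coeff q γ) (lookup∘updateAt v α) (raise-lower v α e) ⟩
    suc m · coeff q α                                            ∎

  ∂-cong : ∀ v (q r : Poly n) → q ≈ᴾ r → ∂ v q ≈ᴾ ∂ v r
  ∂-cong v q r q≈r α =
    trans (coeff-∂ v q α) (trans (×-congʳ (suc (lookup α v)) (q≈r _)) (sym (coeff-∂ v r α)))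

  -- Raising at u leaves the exponent at v alone because u ≠ v; for u = v the inner factor would be
  -- one larger.
  coeff-∂-∂ : ∀ {u v} → u ≢ v → ∀ (q : Poly n) α → coeff (∂ u (∂ v q)) α ≈
              suc (lookup α u) · (suc (lookup α v) · coeff q (raise v (raise u α)))
  coeff-∂-∂ {u = u} {v} u≢v q α =
    trans (coeff-∂ u (∂ v q) α) (×-congʳ (suc (lookup α u)) (trans (coeff-∂ v q _)
      (×-congˡ (≡.cong suc (lookup∘updateAt′ v u (u≢v ∘ ≡.sym) α)))))

  ∂-comm : ∀ u v (q : Poly n) → ∂ u (∂ v q) ≈ᴾ ∂ v (∂ u q)
  ∂-comm u v q α with u Fin.≟ v
  ... | yes ≡.refl = refl
  ... | no u≢v = begin
    coeff (∂ u (∂ v q)) α                          ≈⟨ coeff-∂-∂ u≢v q α ⟩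
    suc αᵤ · (suc αᵥ · coeff q (raise v (raise u α))) ≈⟨ ·-comm (suc αᵤ) (suc αᵥ) _ ⟩
    suc αᵥ · (suc αᵤ · coeff q (raise v (raise u α))) ≡⟨ ≡.cong (λ γ → suc αᵥ · (suc αᵤ · coeff q γ)) (updateAt-commutes v u (u≢v ∘ ≡.sym) α) ⟩
    suc αᵥ · (suc αᵤ · coeff q (raise u (raise v α))) ≈⟨ coeff-∂-∂ (u≢v ∘ ≡.sym) q α ⟨
    coeff (∂ v (∂ u q)) α                          ∎
    where
    αᵤ = lookup α u
    αᵥ = lookup α v

  -- A monomial with a positive exponent at v has its coefficient recovered from `∂ v` by cancelling
  -- that exponent. Derivatives do not see the constant term, hence the second hypothesis.
  ∂-injective : ∀ (q r : Poly n) → (∀ v → ∂ v q ≈ᴾ ∂ v r) →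
                (∀ α → degree α ≡ 0 → coeff q α ≈ coeff r α) → q ≈ᴾ r
  ∂-injective q r ∂q≈∂r constant α with degree≡0⊎positive-exponent α
  ... | inj₁ e           = constant α e
  ... | inj₂ (v , m , e) = ·-cancel m
    (trans (sym (coeff-∂-lower v q α e)) (trans (∂q≈∂r v _) (coeff-∂-lower v r α e)))

  coeff-differential : ∀ a (q : Poly n) α →
    coeff (differential a q) α ≈ sum (λ v → a v * coeff (∂ v q) α)
  coeff-differential a q α =
    trans (coeff-concatMap-tabulate (λ v → scale (a v) (∂ v q)) id α)
      (sum-cong-≋ (λ v → coeff-scale (a v) (∂ v q) α))

  differential-cong-∂ : ∀ a (q r : Poly n) {α} → (∀ v → coeff (∂ v q) α ≈ coeff (∂ v r) α) →
                        coeff (differential a q) α ≈ coeff (differential a r) α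
  differential-cong-∂ a q r {α} e = trans (coeff-differential a q α)
    (trans (sum-cong-≋ (λ v → *-congˡ (e v))) (sym (coeff-differential a r α)))

  differential-0 : ∀ a (q : Poly n) {α} → (∀ v → coeff (∂ v q) α ≈ 0#) →
                   coeff (differential a q) α ≈ 0#
  differential-0 a q {α} e = trans (coeff-differential a q α)
    (sum-0 (λ v → trans (*-congˡ (e v)) (zeroʳ (a v))))

  -- The coefficients `a w` are constants, so this reduces to `∂-comm` term by term. It serves both
  -- for ω and for the coordinate equations of a stress.
  ∂-differential : ∀ v a (q : Poly n) → ∂ v (differential a q) ≈ᴾ differential a (∂ v q)
  ∂-differential v a q α = begin
    coeff (∂ v (differential a q)) α
      ≈⟨ coeff-∂ v (differential a q) α ⟩
    l · coeff (differential a q) (raise v α)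
      ≈⟨ ×-congʳ l (coeff-differential a q _) ⟩
    l · sum (λ w → a w * coeff (∂ w q) (raise v α))
      ≈⟨ ·-distrib-sum l (λ w → a w * coeff (∂ w q) (raise v α)) ⟩
    sum (λ w → l · (a w * coeff (∂ w q) (raise v α)))
      ≈⟨ sum-cong-≋ (λ w → ×-comm-* l (a w) (coeff (∂ w q) (raise v α))) ⟨
    sum (λ w → a w * (l · coeff (∂ w q) (raise v α)))
      ≈⟨ sum-cong-≋ (λ w → *-congˡ {a w} (trans (∂-comm w v q α) (coeff-∂ v (∂ w q) α))) ⟨
    sum (λ w → a w * coeff (∂ w (∂ v q)) α)
      ≈⟨ coeff-differential a (∂ v q) α ⟨
    coeff (differential a (∂ v q)) α ∎
    where l = suc (lookup α v)

  -- Antiderivatives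

  infixr 7 X_∙_

  X_∙_ : Fin n → Poly n → Poly n
  X v ∙ q = List.map (λ (c , β) → c , raise v β) q

  coeff-X-0 : ∀ v (q : Poly n) α → lookup α v ≡ 0 → coeff (X v ∙ q) α ≈ 0#
  coeff-X-0 v []            α e = refl
  coeff-X-0 v ((c , β) ∷ q) α e
    rewrite dec-false (≡-dec ℕₚ._≟_ (raise v β) α)
      (λ { ≡.refl → ℕₚ.0≢1+n (≡.trans (≡.sym e) (lookup-raise v β)) })
    = trans (+-identityˡ _) (coeff-X-0 v q α e)

  coeff-X-raise : ∀ v (q : Poly n) α → coeff (X v ∙ q) (raise v α) ≈ coeff q α
  coeff-X-raise v []            α = refl
  coeff-X-raise v ((c , β) ∷ q) α
    rewrite does-⇔ (mk⇔ (raise-injective v) (≡.cong (raise v)))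
              (≡-dec ℕₚ._≟_ (raise v β) (raise v α)) (≡-dec ℕₚ._≟_ β α)
    = +-congˡ (coeff-X-raise v q α)

  coeff-X-lower : ∀ v (q : Poly n) α {m} → lookup α v ≡ suc m →
                  coeff (X v ∙ q) α ≈ coeff q (α [ v ]≔ m)
  coeff-X-lower v q α e = trans
    (reflexive (≡.cong (coeff (X v ∙ q)) (≡.sym (raise-lower v α e))))
    (coeff-X-raise v q _)

  -- Closedness of the 1-form Σ_v g_v dx_v; the polynomial Poincaré lemma below provides a
  -- potential.
  Closed : (Fin n → Poly n) → Set
  Closed g = ∀ u v → ∂ u (g v) ≈ᴾ ∂ v (g u)

  -- For u ≠ v both sides are the coefficient of α in x_u x_v ∂_u g_v = x_u x_v ∂_v g_u.
  closed-exchange : ∀ (g : Fin n → Poly n) → Closed g → ∀ u v α →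
    lookup α u · coeff (X v ∙ g v) α ≈ lookup α v · coeff (X u ∙ g u) α
  closed-exchange g closed u v α
    with u Fin.≟ v | lookup α u in eᵤ | lookup α v in eᵥ
  ... | yes ≡.refl | _     | _     = ×-congˡ (≡.trans (≡.sym eᵤ) eᵥ)
  ... | no _       | zero  | m     = sym (trans (×-congʳ m (coeff-X-0 u (g u) α eᵤ)) (·-zeroʳ m))
  ... | no _       | suc l | zero  = trans (×-congʳ (suc l) (coeff-X-0 v (g v) α eᵥ)) (·-zeroʳ (suc l))
  ... | no u≢v     | suc l | suc m = begin
    suc l · coeff (X v ∙ g v) α            ≈⟨ ×-congʳ (suc l) (coeff-X-lower v (g v) α eᵥ) ⟩
    suc l · coeff (g v) αᵥ                 ≈⟨ coeff-∂-lower u (g v) αᵥ eᵥᵤ ⟨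
    coeff (∂ u (g v)) (αᵥ [ u ]≔ l)        ≈⟨ closed u v _ ⟩
    coeff (∂ v (g u)) (αᵥ [ u ]≔ l)        ≡⟨ ≡.cong (coeff (∂ v (g u))) (updateAt-commutes u v u≢v α) ⟩
    coeff (∂ v (g u)) (αᵤ [ v ]≔ m)        ≈⟨ coeff-∂-lower v (g u) αᵤ eᵤᵥ ⟩
    suc m · coeff (g u) αᵤ                 ≈⟨ ×-congʳ (suc m) (coeff-X-lower u (g u) α eᵤ) ⟨
    suc m · coeff (X u ∙ g u) α            ∎
    where
    αᵤ = α [ u ]≔ l
    αᵥ = α [ v ]≔ m
    eᵥᵤ : lookup αᵥ u ≡ suc l
    eᵥᵤ = ≡.trans (lookup∘updateAt′ u v u≢v α) eᵤ
    eᵤᵥ : lookup αᵤ v ≡ suc m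
    eᵤᵥ = ≡.trans (lookup∘updateAt′ v u (u≢v ∘ ≡.sym) α) eᵥ

  Homogeneous : ℕ → Poly n → Set
  Homogeneous k q = ∀ α → degree α ≢ k → coeff q α ≈ 0#

  -- The potential dictated by Euler's identity. Here `k` is the degree of the g_v, so the potential
  -- has degree k + 1, and `reciprocal k` is 1 / (k + 1).
  antiderivative : ℕ → (Fin n → Poly n) → Poly n
  antiderivative k g =
    scale (reciprocal k) (List.concatMap (λ v → X v ∙ g v) (List.allFin _))

  coeff-antiderivative : ∀ k (g : Fin n → Poly n) α →
    coeff (antiderivative k g) α ≈ reciprocal k * sum (λ v → coeff (X v ∙ g v) α)
  coeff-antiderivative k g α = trans
    (coeff-scale (reciprocal k) (List.concatMap (λ v → X v ∙ g v) (List.allFin _)) α)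
    (*-congˡ (coeff-concatMap-tabulate (λ v → X v ∙ g v) id α))

  antiderivative-constant : ∀ k (g : Fin n → Poly n) α → degree α ≡ 0 →
                            coeff (antiderivative k g) α ≈ 0#
  antiderivative-constant k g α e = trans (coeff-antiderivative k g α) (trans
    (*-congˡ (sum-0 (λ v → coeff-X-0 v (g v) α (degree≡0⇒lookup≡0 α e v))))
    (zeroʳ (reciprocal k)))

  -- At γ = x_u α, `closed-exchange` turns the summand for v into γ_v times the coefficient of α in
  -- g_u. The γ_v add up to the degree of γ, which cancels against `reciprocal k`.
  ∂-antiderivative : ∀ {k} (g : Fin n → Poly n) → Closed g → (∀ v → Homogeneous k (g v)) →
                     ∀ v → ∂ v (antiderivative k g) ≈ᴾ g v
  ∂-antiderivative {k = k} g closed homogeneous u α = begin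
    coeff (∂ u (antiderivative k g)) α
      ≈⟨ coeff-∂ u (antiderivative k g) α ⟩
    l · coeff (antiderivative k g) γ
      ≈⟨ ×-congʳ l (coeff-antiderivative k g γ) ⟩
    l · (reciprocal k * sum (λ v → coeff (X v ∙ g v) γ))
      ≈⟨ ×-comm-* l (reciprocal k) _ ⟨
    reciprocal k * (l · sum (λ v → coeff (X v ∙ g v) γ))
      ≈⟨ *-congˡ (·-distrib-sum l (λ v → coeff (X v ∙ g v) γ)) ⟩
    reciprocal k * sum (λ v → l · coeff (X v ∙ g v) γ)
      ≈⟨ *-congˡ (sum-cong-≋ exchange) ⟩
    reciprocal k * sum (λ v → lookup γ v · coeff (g u) α)
      ≈⟨ *-congˡ (sum-lookup-· γ (coeff (g u) α)) ⟩
    reciprocal k * (degree γ · coeff (g u) α)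
      ≈⟨ *-congˡ euler ⟩
    reciprocal k * (suc k · coeff (g u) α)
      ≈⟨ reciprocal-· k _ ⟩
    coeff (g u) α ∎
    where
    γ = raise u α
    l = suc (lookup α u)

    exchange : ∀ v → l · coeff (X v ∙ g v) γ ≈ lookup γ v · coeff (g u) α
    exchange v = begin
      l · coeff (X v ∙ g v) γ             ≡⟨ ≡.cong (_· coeff (X v ∙ g v) γ) (≡.sym (lookup-raise u α)) ⟩
      lookup γ u · coeff (X v ∙ g v) γ    ≈⟨ closed-exchange g closed u v γ ⟩
      lookup γ v · coeff (X u ∙ g u) γ    ≈⟨ ×-congʳ (lookup γ v) (coeff-X-raise u (g u) α) ⟩
      lookup γ v · coeff (g u) α          ∎

    -- If α does not have degree k, the factors may differ, but homogeneity makes both sides 0.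
    euler : degree γ · coeff (g u) α ≈ suc k · coeff (g u) α
    euler with degree α ℕₚ.≟ k
    ... | yes ≡.refl = ×-congˡ (degree-raise u α)
    ... | no deg≢k   = begin
      degree γ · coeff (g u) α  ≈⟨ ×-congʳ (degree γ) vanishes ⟩
      degree γ · 0#             ≈⟨ ·-zeroʳ (degree γ) ⟩
      0#                        ≈⟨ ·-zeroʳ (suc k) ⟨
      suc k · 0#                ≈⟨ ×-congʳ (suc k) vanishes ⟨
      suc k · coeff (g u) α     ∎
      where
      vanishes : coeff (g u) α ≈ 0#
      vanishes = homogeneous u α deg≢k

  -- Polynomials spanned by a set of monomials.

  All⇒coeff-0 : ∀ {P : Pred (Monomial n) 0ℓ} {q : Poly n} → All (P ∘ proj₂) q →
                ∀ α → ¬ P α → coeff q α ≈ 0#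
  All⇒coeff-0 []                           α ¬Pα = refl
  All⇒coeff-0 {q = (c , β) ∷ q} (Pβ ∷ all) α ¬Pα
    rewrite dec-false (≡-dec ℕₚ._≟_ β α) (λ { ≡.refl → ¬Pα Pβ })
    = trans (+-identityˡ _) (All⇒coeff-0 all α ¬Pα)

  coeff-filter : ∀ {P : Pred (Monomial n) 0ℓ} (P? : Decidable P) (q : Poly n) {α} → P α →
                 coeff (List.filter (P? ∘ proj₂) q) α ≈ coeff q α
  coeff-filter P? []            Pα = refl
  coeff-filter P? ((c , β) ∷ q) {α} Pα with P? β
  ... | yes _  = +-congˡ (coeff-filter P? q Pα)
  ... | no ¬Pβ
    rewrite dec-false (≡-dec ℕₚ._≟_ β α) (λ { ≡.refl → ¬Pβ Pα })
    = trans (coeff-filter P? q Pα) (sym (+-identityˡ _))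

  -- M is the set of monomials allowed in a stress, and p i v is the i-th
  -- coordinate of the vertex v.
  module Stresses {M : Pred (Monomial n) 0ℓ}
    (M-lower : ∀ v {α} → M (raise v α) → M α) (p : Fin d → Fin n → Carrier) where

    -- Support and degree are conditions on vanishing coefficients, so they can be checked one
    -- monomial at a time; `stress⁻` and `stress⁺` translate from and to the list-based spans.
    Stress : ℕ → Pred (Poly n) 0ℓ
    Stress k q =
      (∀ α → ¬ M α → coeff q α ≈ 0#) × (∀ i → differential (p i) q ≈ᴾ []) × Homogeneous k q

    ω-Surjective ω-Injective : (Fin n → Carrier) → ℕ → Set
    ω-Surjective a k = ∀ q → Stress k q → ∃[ r ] (Stress (suc k) r × differential a r ≈ᴾ q)
    ω-Injective a k =
      ∀ q r → Stress k q → Stress k r → differential a q ≈ᴾ differential a r → q ≈ᴾ r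

    constant-0 : ∀ {k} q → Stress (suc k) q → ∀ α → degree α ≡ 0 → coeff q α ≈ 0#
    constant-0 q (_ , _ , homogeneous) α deg≡0 =
      homogeneous α (λ deg → ℕₚ.0≢1+n (≡.trans (≡.sym deg≡0) deg))

    -- The coefficient at α is a multiple of the one of `q` at x_v α, which is forbidden by support
    -- or degree whenever α is. The equations follow from `∂-differential`.
    ∂-stress : ∀ {k} v q → Stress (suc k) q → Stress k (∂ v q)
    ∂-stress {k} v q (supported , equations , homogeneous) =
      (λ α ¬Mα → raised-0 α (supported (raise v α) (¬Mα ∘ M-lower v))) ,
      (λ i α → trans (sym (∂-differential v (p i) q α)) (∂-cong v (differential (p i) q) [] (equations i) α)) ,
      (λ α deg≢k → raised-0 α (homogeneous (raise v α)
        (deg≢k ∘ ℕₚ.suc-injective ∘ ≡.trans (≡.sym (degree-raise v α)))))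
      where
      raised-0 : ∀ α → coeff q (raise v α) ≈ 0# → coeff (∂ v q) α ≈ 0#
      raised-0 α e = trans (coeff-∂ v q α)
        (trans (×-congʳ (suc (lookup α v)) e) (·-zeroʳ (suc (lookup α v))))

    -- Constructive contrapositive of: a monomial of degree k lies in M if all its quotients α / x_v
    -- do. Missing faces enter here, through `nonface-lower`.
    Liftable : ℕ → Set
    Liftable k = ∀ α → degree α ≡ k → ¬ M α →
      ∃[ v ] ∃[ m ] (lookup α v ≡ suc m × ¬ M (α [ v ]≔ m))

    -- Since `∂ v r` is g_v, a coefficient of `r` at α vanishes as soon as that of some g_v at α /
    -- x_v does. This passes support and homogeneity up from the g_v.
    antiderivative-stress : ∀ {k} → Liftable (suc (suc k)) →
      ∀ g → Closed g → (∀ v → Stress (suc k) (g v)) →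
      Stress (suc (suc k)) (antiderivative (suc k) g)
    antiderivative-stress {k} liftable g closed stress = supported , equations , homogeneous
      where
      r = antiderivative (suc k) g

      g-homogeneous : ∀ v → Homogeneous (suc k) (g v)
      g-homogeneous v = proj₂ (proj₂ (stress v))

      ∂r≈g : ∀ v → ∂ v r ≈ᴾ g v
      ∂r≈g = ∂-antiderivative g closed g-homogeneous

      lowered-0 : ∀ v α {m} → lookup α v ≡ suc m → coeff (g v) (α [ v ]≔ m) ≈ 0# → coeff r α ≈ 0#
      lowered-0 v α {m} e vanishes = ·-cancel-0 m
        (trans (sym (coeff-∂-lower v r α e)) (trans (∂r≈g v _) vanishes))

      homogeneous : Homogeneous (suc (suc k)) r
      homogeneous α deg≢ with degree≡0⊎positive-exponent α
      ... | inj₁ e           = antiderivative-constant (suc k) g α e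
      ... | inj₂ (v , m , e) = lowered-0 v α e
        (g-homogeneous v _ (deg≢ ∘ ≡.trans (degree-lower v α e) ∘ ≡.cong suc))

      supported : ∀ α → ¬ M α → coeff r α ≈ 0#
      supported α ¬Mα with degree α ℕₚ.≟ suc (suc k)
      -- `liftable` speaks about degree k + 2 only; all other degrees are covered by homogeneity.
      ... | no deg≢ = homogeneous α deg≢
      ... | yes deg with liftable α deg ¬Mα
      ...   | v , m , e , ¬Mlower = lowered-0 v α e (proj₁ (stress v) _ ¬Mlower)

      equations : ∀ i → differential (p i) r ≈ᴾ []
      equations i = ∂-injective (differential (p i) r) []
        (λ v α → trans (∂-differential v (p i) r α) (trans
          (differential-cong-∂ (p i) (∂ v r) (g v) (λ w → ∂-cong w (∂ v r) (g v) (∂r≈g v) α))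
          (proj₁ (proj₂ (stress v)) i α)))
        -- The g_v have positive degree k + 1, hence no constant term.
        (λ α deg≡0 → differential-0 (p i) r
          (λ v → trans (∂r≈g v α) (constant-0 (g v) (stress v) α deg≡0)))

    -- Passing from degree k to degree k + 1.

    ω-injective-suc : ∀ a k → ω-Injective a k → ω-Injective a (suc k)
    ω-injective-suc a k injective q r stress-q stress-r ωq≈ωr = ∂-injective q r
      (λ v → injective (∂ v q) (∂ v r) (∂-stress v q stress-q) (∂-stress v r stress-r)
        (λ α → trans (sym (∂-differential v a q α))
          (trans (∂-cong v (differential a q) (differential a r) ωq≈ωr α) (∂-differential v a r α))))
      (λ α deg≡0 → trans (constant-0 q stress-q α deg≡0) (sym (constant-0 r stress-r α deg≡0)))

    ω-surjective-suc : ∀ a k → Liftable (suc (suc k)) →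
      ω-Surjective a k → ω-Injective a k → ω-Surjective a (suc k)
    ω-surjective-suc a k liftable surjective injective q stress =
      r , antiderivative-stress liftable g closed g-stress , ωr≈q
      where
      lift : ∀ v → ∃[ r ] (Stress (suc k) r × differential a r ≈ᴾ ∂ v q)
      lift v = surjective (∂ v q) (∂-stress v q stress)

      g : Fin n → Poly n
      g v = proj₁ (lift v)

      g-stress : ∀ v → Stress (suc k) (g v)
      g-stress v = proj₁ (proj₂ (lift v))

      ωg≈∂q : ∀ v → differential a (g v) ≈ᴾ ∂ v q
      ωg≈∂q v = proj₂ (proj₂ (lift v))

      ω∂g : ∀ u v → differential a (∂ u (g v)) ≈ᴾ ∂ u (∂ v q)
      ω∂g u v α = trans (sym (∂-differential u a (g v) α)) (∂-cong u (differential a (g v)) (∂ v q) (ωg≈∂q v) α)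

      -- Both sides are stresses of degree k, and ω maps both to the same second derivative of `q`.
      closed : Closed g
      closed u v = injective (∂ u (g v)) (∂ v (g u))
        (∂-stress u (g v) (g-stress v)) (∂-stress v (g u) (g-stress u))
        (λ α → trans (ω∂g u v α) (trans (∂-comm u v q α) (sym (ω∂g v u α))))

      r = antiderivative (suc k) g

      ∂r≈g : ∀ v → ∂ v r ≈ᴾ g v
      ∂r≈g = ∂-antiderivative g closed (λ v → proj₂ (proj₂ (g-stress v)))

      ωr≈q : differential a r ≈ᴾ q
      ωr≈q = ∂-injective (differential a r) q
        (λ v α → trans (∂-differential v a r α) (trans
          (differential-cong-∂ a (∂ v r) (g v) (λ w → ∂-cong w (∂ v r) (g v) (∂r≈g v) α))
          (ωg≈∂q v α)))
        (λ α deg≡0 → trans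
          (differential-0 a r (λ v → trans (∂r≈g v α) (constant-0 (g v) (g-stress v) α deg≡0)))
          (sym (constant-0 q stress α deg≡0)))

-- Transfer to the real numbers

open import Defs

open CommutativeRing ℝ-ring using (0#; sym; trans)

-- Operations on constant sequences compute termwise, so every law is reflexivity at a constant
-- sequence, which is exactly its `cauchy` field.
fromℚ-homomorphic : SemiringMorphisms.IsSemiringHomomorphism ℚ.+-*-rawSemiring
  (Semiring.rawSemiring (CommutativeRing.semiring ℝ-ring)) fromℚ
fromℚ-homomorphic = record
  { isNearSemiringHomomorphism = record
    { +-isMonoidHomomorphism = record
      { isMagmaHomomorphism = record
        { isRelHomomorphism = record { cong = λ { {x} ≡.refl → mk≈ (cauchy (fromℚ x)) } }
        ; homo = λ x y → mk≈ (cauchy (fromℚ (x ℚ.+ y)))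
        }
      ; ε-homo = mk≈ (cauchy (fromℚ 0ℚ))
      }
    ; *-homo = λ x y → mk≈ (cauchy (fromℚ (x ℚ.* y)))
    }
  ; 1#-homo = mk≈ (cauchy (fromℚ 1ℚ))
  }

module P = Polynomials ℝ-ring fromℚ-homomorphic

-- Real numbers are identified only when their sequences agree termwise; unlike
-- propositional equality in ℝ, this does not compare proofs of being Cauchy.
infix 4 _≗ℝ_ _≗ᴾ_

_≗ℝ_ : ℝ → ℝ → Set
x ≗ℝ y = ∀ i → seq x i ≡ seq y i

≗⇒≈ : ∀ x y → x ≗ℝ y → x ≈ℝ y
≗⇒≈ x y x≗y .same-limit .close ε 0<ε with close (cauchy x) ε 0<ε
... | N , h = N , λ i j p q →
  ≡.subst (λ t → ℚ.∣ seq x i ℚ.- t ∣ ℚ.< ε) (x≗y j) (h i j p q)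

-- The two versions of each operation yield lists with the same monomials in the same order, so
-- terms can be matched one by one.
_≗ᴾ_ : Poly n → Poly n → Set
_≗ᴾ_ = Pointwise (λ (c , β) (c′ , β′) → c ≗ℝ c′ × β ≡ β′)

≗ᴾ-refl : ∀ (q : Poly n) → q ≗ᴾ q
≗ᴾ-refl q = Pointwise.refl ((λ _ → ≡.refl) , ≡.refl)

coeff-≗ : ∀ {q r : Poly n} → q ≗ᴾ r → ∀ α → coeff q α ≗ℝ P.coeff r α
coeff-≗ []                       α i = ≡.refl
coeff-≗ (_∷_ {_ , β} (e , ≡.refl) q≗r) α i with does (≡-dec ℕₚ._≟_ β α)
... | true  = ≡.cong₂ ℚ._+_ (e i) (coeff-≗ q≗r α i)
... | false = ≡.cong (0ℚ ℚ.+_) (coeff-≗ q≗r α i)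

∂-≗ : ∀ v (q : Poly n) → ∂ v q ≗ᴾ P.∂ v q
∂-≗ v []            = []
∂-≗ v ((c , β) ∷ q) with lookup β v
... | zero  = ∂-≗ v q
... | suc m = ((λ _ → ≡.refl) , ≡.refl) ∷ ∂-≗ v q

scale-≗ : ∀ a {q r : Poly n} → q ≗ᴾ r → scale a q ≗ᴾ P.scale a r
scale-≗ a []                  = []
scale-≗ a ((e , ≡.refl) ∷ q≗r) = ((λ i → ≡.cong (seq a i ℚ.*_) (e i)) , ≡.refl) ∷ scale-≗ a q≗r

concatMap-≗ : ∀ {A : Set} {f g : A → Poly n} → (∀ x → f x ≗ᴾ g x) →
              ∀ xs → List.concatMap f xs ≗ᴾ List.concatMap g xs
concatMap-≗ f≗g []       = []
concatMap-≗ f≗g (x ∷ xs) = Pointwise.++⁺ (f≗g x) (concatMap-≗ f≗g xs)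

differential-≗ : ∀ a (q : Poly n) → differential a q ≗ᴾ P.differential a q
differential-≗ {n} a q = concatMap-≗ (λ v → scale-≗ (a v) (∂-≗ v q)) (List.allFin n)

coeff-P : ∀ (q : Poly n) α → coeff q α ≈ℝ P.coeff q α
coeff-P q α = ≗⇒≈ (coeff q α) (P.coeff q α) (coeff-≗ (≗ᴾ-refl q) α)

coeff-differential-P : ∀ a (q : Poly n) α →
  coeff (differential a q) α ≈ℝ P.coeff (P.differential a q) α
coeff-differential-P a q α =
  ≗⇒≈ (coeff (differential a q) α) (P.coeff (P.differential a q) α) (coeff-≗ (differential-≗ a q) α)

-- Monomial spans as vanishing conditions on coefficients.

MonomialSpan⁻ : ∀ {P : Pred (Monomial n) 0ℓ} q → MonomialSpan P q →
                ∀ α → ¬ P α → P.coeff q α ≈ℝ 0#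
MonomialSpan⁻ q (r , all , q≈r) α ¬Pα =
  trans (sym (coeff-P q α)) (trans (q≈r α) (trans (coeff-P r α) (P.All⇒coeff-0 all α ¬Pα)))

-- The list `q` itself may contain terms outside P that cancel; filtering them out gives the witness
-- without changing any coefficient.
MonomialSpan⁺ : ∀ {P : Pred (Monomial n) 0ℓ} → Decidable P → ∀ q →
                (∀ α → ¬ P α → P.coeff q α ≈ℝ 0#) → MonomialSpan P q
MonomialSpan⁺ {P = P} P? q vanishes = r , all-filter (P? ∘ proj₂) q ,
  λ α → trans (coeff-P q α) (trans (agrees α) (sym (coeff-P r α)))
  where
  r = List.filter (P? ∘ proj₂) q

  agrees : q P.≈ᴾ r
  agrees α with P? α
  ... | yes Pα = sym (P.coeff-filter P? q Pα)
  ... | no ¬Pα = trans (vanishes α ¬Pα) (sym (P.All⇒coeff-0 (all-filter (P? ∘ proj₂) q) α ¬Pα))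

-- Stresses and missing faces of a complex.

module _ (Δ : GeometricComplex n d) where
  open GeometricComplex Δ

  face-lower : ∀ v {α} → Face (support (raise v α)) → Face (support α)
  face-lower v {α} = down-closed support⊆
    where
    support⊆ : support α ⊆ support (raise v α)
    support⊆ {w} w∈ with w Fin.≟ v
    ... | yes ≡.refl = ∈-support⁺ (raise v α) v (lookup-raise v α)
    ... | no w≢v with ∈-support⁻ α w w∈
    ...   | m , e = ∈-support⁺ (raise v α) w (≡.trans (lookup∘updateAt′ w v w≢v α) e)

  module FaceStresses = P.Stresses {M = Face ∘ support} face-lower (λ i v → position v i)

  stress⁻ : ∀ k q → StressOfDegree Δ (+ k) q → FaceStresses.Stress k q
  stress⁻ k q ((faces , equations) , homogeneous) =
    MonomialSpan⁻ q faces ,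
    (λ i α → trans (sym (coeff-differential-P (λ v → position v i) q α)) (equations i α)) ,
    (λ α deg≢k → MonomialSpan⁻ q homogeneous α (deg≢k ∘ ℤₚ.+-injective))

  stress⁺ : ∀ k q → FaceStresses.Stress k q → StressOfDegree Δ (+ k) q
  stress⁺ k q (supported , equations , homogeneous) =
    ( MonomialSpan⁺ (face? ∘ support) q supported
    , (λ i α → trans (coeff-differential-P (λ v → position v i) q α) (equations i α))) ,
    MonomialSpan⁺ (λ α → + degree α ℤₚ.≟ + k) q
      (λ α deg≢k → homogeneous α (λ deg≡k → deg≢k (≡.cong (λ l → + l) deg≡k)))

  Lowerable : Monomial n → Pred (Fin n) 0ℓ
  Lowerable α v = ∃[ m ] (lookup α v ≡ suc m × ¬ Face (support (α [ v ]≔ m)))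

  -- Lets `Fin.any?` search all vertices, so that a failed search shows every quotient to be
  -- supported on a face.
  lowerable? : ∀ α → Decidable (Lowerable α)
  lowerable? α v with lookup α v
  ... | zero = no λ { (_ , () , _) }
  ... | suc m with face? (support (α [ v ]≔ m))
  ...   | yes face   = no λ { (_ , ≡.refl , ¬face) → ¬face face }
  ...   | no  ¬face  = yes (m , ≡.refl , ¬face)

  -- This is `Liftable` in degree k + 2. A failed search would make `support α` a missing face of
  -- dimension k + 1.
  nonface-lower : ∀ {k} → (∀ σ → MissingFace Δ σ → dim σ ≢ + suc k) →
    ∀ α → degree α ≡ suc (suc k) → ¬ Face (support α) → ∃[ v ] Lowerable α v
  nonface-lower {k} noMissing α deg ¬face with Fin.any? (lowerable? α)
  ... | yes found = found
  ... | no  none  = contradiction dimension (noMissing (support α) (¬face , minimal))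
    where
    lowered-face : ∀ v {m} → lookup α v ≡ suc m → Face (support (α [ v ]≔ m))
    lowered-face v {m} e with face? (support (α [ v ]≔ m))
    ... | yes face   = face
    ... | no  ¬face′ = contradiction (v , m , e , ¬face′) none

    squarefree : ∀ v → lookup α v ℕ.≤ 1
    squarefree v with lookup α v in e
    ... | zero        = z≤n
    ... | suc zero    = s≤s z≤n
    -- Lowering an exponent of at least 2 keeps the support, which would then be a face.
    ... | suc (suc m) = contradiction (down-closed support⊆ (lowered-face v e)) ¬face
      where
      support⊆ : support α ⊆ support (α [ v ]≔ suc m)
      support⊆ {w} w∈ with w Fin.≟ v
      ... | yes ≡.refl = ∈-support⁺ (α [ v ]≔ suc m) v (lookup∘updateAt v α)
      ... | no w≢v     = ∈-support-lower α w≢v w∈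

    dimension : dim (support α) ≡ + suc k
    dimension = ≡.cong (λ l → + l ℤ.- + 1) (≡.trans (∣support∣≡degree α squarefree) deg)

    minimal : ∀ τ → τ ⊆ support α → ¬ Face τ → τ ≡ support α
    minimal τ τ⊆ ¬faceτ = ⊆-antisym τ⊆ support⊆
      where
      support⊆ : support α ⊆ τ
      support⊆ {v} v∈ with v ∈? τ
      ... | yes v∈τ = v∈τ
      -- A subset of `support α` that omits v lies in the support of α / x_v, which is a face.
      ... | no  v∉τ with ∈-support⁻ α v v∈
      ...   | m , e = contradiction (down-closed τ⊆lower (lowered-face v e)) ¬faceτ
        where
        τ⊆lower : τ ⊆ support (α [ v ]≔ m)
        τ⊆lower w∈τ = ∈-support-lower α (λ { ≡.refl → v∉τ w∈τ }) (τ⊆ w∈τ)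

theorem4p5 : ∀ {n d : ℕ} (Δ : GeometricComplex n d) (a : Vector n) (k : ℕ) →
    Proper Δ →
    ToricChordal Δ a (+ k) →
    (∀ σ → MissingFace Δ σ → dim σ ≢ + suc k) →
    ToricChordal Δ a (+ suc k)
theorem4p5 Δ a k _ (surjective , injective) noMissing = surjective′ , injective′
  where
  module S = FaceStresses Δ

  -- The hypotheses are first put into coefficient form; the conclusions are carried back the same
  -- way.
  ω-surjective : S.ω-Surjective a k
  ω-surjective q stress =
    let r , stress-r , ωr≈q = surjective q (stress⁺ Δ k q stress)
    in r , stress⁻ Δ (suc k) r stress-r , λ α →
      trans (sym (coeff-differential-P a r α)) (trans (ωr≈q α) (coeff-P q α))

  ω-injective : S.ω-Injective a k
  ω-injective q r stress-q stress-r ωq≈ωr α =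
    trans (sym (coeff-P q α)) (trans (q≈r α) (coeff-P r α))
    where
    q≈r : q ≈ᴾ r
    q≈r = injective q r (stress⁺ Δ k q stress-q) (stress⁺ Δ k r stress-r) λ β →
      trans (coeff-differential-P a q β) (trans (ωq≈ωr β) (sym (coeff-differential-P a r β)))

  surjective′ : ∀ q → StressOfDegree Δ (+ suc k) q →
    ∃[ r ] (StressOfDegree Δ (+ suc (suc k)) r × differential a r ≈ᴾ q)
  surjective′ q stress =
    let r , stress-r , ωr≈q =
          S.ω-surjective-suc a k (nonface-lower Δ noMissing) ω-surjective ω-injective q
            (stress⁻ Δ (suc k) q stress)
    in r , stress⁺ Δ (suc (suc k)) r stress-r , λ α →
      trans (coeff-differential-P a r α) (trans (ωr≈q α) (sym (coeff-P q α)))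

  injective′ : ∀ q r → StressOfDegree Δ (+ suc k) q → StressOfDegree Δ (+ suc k) r →
               differential a q ≈ᴾ differential a r → q ≈ᴾ r
  injective′ q r stress-q stress-r ωq≈ωr α =
    trans (coeff-P q α) (trans (q≈r α) (sym (coeff-P r α)))
    where
    q≈r : q P.≈ᴾ r
    q≈r = S.ω-injective-suc a k ω-injective q r
      (stress⁻ Δ (suc k) q stress-q) (stress⁻ Δ (suc k) r stress-r) λ β →
      trans (sym (coeff-differential-P a q β)) (trans (ωq≈ωr β) (coeff-differential-P a r β))
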